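{- Let $\mathbf{A}$ be a finite set of indeterminates and $X,Y\notin\mathbf{A}$ distinct. Consider the equation system $\mathcal{E}\colon X=P(X,Y),\ Y=Q(X,Y)$ with $P,Q\in\mathbb{S}^{\infty}[\mathbf{A}\cup\{X,Y\}]$. Let $H(Y)\in\mathbb{S}^{\infty}[\mathbf{A}\cup\{Y\}]$ be the greatest solution in $\mathbb{S}^{\infty}[\mathbf{A}\cup\{Y\}]$ of the equation $X=P(X,Y)$ (treating $Y$ as a coefficient indeterminate), and let $b\in\mathbb{S}^{\infty}[\mathbf{A}]$ be the greatest solution in $\mathbb{S}^{\infty}[\mathbf{A}]$ of the equation $Y=Q(H(Y),Y)$. Then $(H(b),b)$ is the greatest solution of $\mathcal{E}$ in $\mathbb{S}^{\infty}[\mathbf{A}]$.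
   Context: $\mathbb{S}^{\infty}[\mathbf{Z}]$ for a finite indeterminate set $\mathbf{Z}$: a monomial is a map $m\colon\mathbf{Z}\to\mathbb{N}\cup\{\infty\}$, multiplied by adding exponents; $m_1\succeq m_2$ if $m_1(Z)\le m_2(Z)$ for all $Z$. Elements are (finite) antichains of monomials w.r.t. $\succeq$; $P+Q=\mathsf{Maximals}(P\cup Q)$, $P\cdot Q=\mathsf{Maximals}\{m_1m_2\}$, $0=\emptyset$, $1=\{$constant monomial$\}$. It is an absorptive, fully-continuous commutative semiring, with natural order $a\le b$ iff $a+b=b$; greatest solutions are with respect to this order (componentwise for pairs). Substitution of elements for indeterminates followed by evaluation is written as function application, e.g. $H(b)$, $Q(H(Y),Y)$. -}

module Defs where

open import Data.Nat using (ℕ; zero; suc) renaming (_+_ to _+ℕ_; _≤_ to _≤ℕ_; _≤ᵇ_ to _≤ℕᵇ_)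
open import Data.Bool using (Bool; true; false; _∧_; _∨_; not)
open import Data.Fin using (Fin; zero; suc)
open import Data.Vec using (Vec; []; _∷_; replicate; zipWith)
import Data.Vec as Vec
open import Data.List using (List; []; _∷_; _++_; foldr; filterᵇ; deduplicateᵇ; cartesianProductWith)
open import Data.Bool.ListAction using (any)
import Data.List as List
open import Data.List.Membership.Propositional using (_∈_)
open import Data.List.Relation.Unary.AllPairs using (AllPairs)
open import Data.Vec.Relation.Binary.Pointwise.Inductive using (Pointwise)
open import Data.Product using (_×_; _,_)
open import Relation.Nullary using (¬_)

data ℕ∞ : Set where
  fin : ℕ → ℕ∞
  ∞   : ℕ∞

data _≤∞_ : ℕ∞ → ℕ∞ → Set where
  fin≤fin : ∀ {m n} → m ≤ℕ n → fin m ≤∞ fin n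
  _≤∞∞    : ∀ x → x ≤∞ ∞

_+∞_ : ℕ∞ → ℕ∞ → ℕ∞
fin m +∞ fin n = fin (m +ℕ n)
fin _ +∞ ∞     = ∞
∞     +∞ _     = ∞

_≤∞ᵇ_ : ℕ∞ → ℕ∞ → Bool
fin m ≤∞ᵇ fin n = m ≤ℕᵇ n
fin _ ≤∞ᵇ ∞     = true
∞     ≤∞ᵇ fin _ = false
∞     ≤∞ᵇ ∞     = true

_==∞_ : ℕ∞ → ℕ∞ → Bool
x ==∞ y = (x ≤∞ᵇ y) ∧ (y ≤∞ᵇ x)

-- Monomials over the indeterminate set Fin k : maps Fin k → ℕ ∪ {∞},
-- represented as vectors of exponents.

Monomial : ℕ → Set
Monomial k = Vec ℕ∞ k

_⪰_ : ∀ {k} → Monomial k → Monomial k → Set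
m₁ ⪰ m₂ = Pointwise _≤∞_ m₁ m₂

_⪰ᵇ_ : ∀ {k} → Monomial k → Monomial k → Bool
[]       ⪰ᵇ []       = true
(x ∷ m₁) ⪰ᵇ (y ∷ m₂) = (x ≤∞ᵇ y) ∧ (m₁ ⪰ᵇ m₂)

_==ₘ_ : ∀ {k} → Monomial k → Monomial k → Bool
m₁ ==ₘ m₂ = (m₁ ⪰ᵇ m₂) ∧ (m₂ ⪰ᵇ m₁)

_*ₘ_ : ∀ {k} → Monomial k → Monomial k → Monomial k
_*ₘ_ = zipWith _+∞_

constMon : ∀ {k} → Monomial k
constMon = replicate _ (fin 0)

-- Elements of S^∞[Fin k]: finite antichains of monomials, represented as
-- lists; the carrier is the lists satisfying `Antichain`, equality is
-- equality of the underlying finite sets.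

Poly : ℕ → Set
Poly k = List (Monomial k)

Antichain : ∀ {k} → Poly k → Set
Antichain = AllPairs (λ m m′ → ¬ (m ⪰ m′) × ¬ (m′ ⪰ m))

_≈_ : ∀ {k} → Poly k → Poly k → Set
P ≈ Q = ∀ m → (m ∈ P → m ∈ Q) × (m ∈ Q → m ∈ P)

Maximals : ∀ {k} → Poly k → Poly k
Maximals L = deduplicateᵇ _==ₘ_
  (filterᵇ (λ m → not (any (λ m′ → (m′ ⪰ᵇ m) ∧ not (m′ ==ₘ m)) L)) L)

𝟘 : ∀ {k} → Poly k
𝟘 = []

𝟙 : ∀ {k} → Poly k
𝟙 = constMon ∷ []

infixl 6 _⊕_
infixl 7 _⊗_

_⊕_ : ∀ {k} → Poly k → Poly k → Poly k
P ⊕ Q = Maximals (P ++ Q)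

_⊗_ : ∀ {k} → Poly k → Poly k → Poly k
P ⊗ Q = Maximals (cartesianProductWith _*ₘ_ P Q)

_≤_ : ∀ {k} → Poly k → Poly k → Set
a ≤ b = (a ⊕ b) ≈ b

-- Powers with exponents in ℕ ∪ {∞}.
-- a^∞ is the infimum ⨅ₙ aⁿ; in S^∞[Z] it is given by the closed form
-- Maximals { m^∞ | m ∈ a }, where m^∞ has exponent ∞ on the support of m
-- and 0 elsewhere.

mon∞ : ∀ {k} → Monomial k → Monomial k
mon∞ = Vec.map (λ { (fin zero) → fin zero ; (fin (suc _)) → ∞ ; ∞ → ∞ })

powℕ : ∀ {k} → Poly k → ℕ → Poly k
powℕ a zero    = 𝟙
powℕ a (suc n) = a ⊗ powℕ a n

pow : ∀ {k} → Poly k → ℕ∞ → Poly k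
pow a (fin n) = powℕ a n
pow a ∞       = Maximals (List.map mon∞ a)

evalMon : ∀ {k j} → Monomial k → (Fin k → Poly j) → Poly j
evalMon []      σ = 𝟙
evalMon (e ∷ m) σ = pow (σ zero) e ⊗ evalMon m (λ i → σ (suc i))

eval : ∀ {k j} → Poly k → (Fin k → Poly j) → Poly j
eval P σ = foldr (λ m acc → evalMon m σ ⊕ acc) 𝟘 P

unitMon : ∀ {k} → Fin k → Monomial k
unitMon {suc k} zero    = fin 1 ∷ constMon
unitMon {suc k} (suc i) = fin 0 ∷ unitMon i

var : ∀ {k} → Fin k → Poly k
var i = unitMon i ∷ []

_∷ˢ_ : ∀ {k j} → Poly j → (Fin k → Poly j) → Fin (suc k) → Poly j
(a ∷ˢ σ) zero    = a
(a ∷ˢ σ) (suc i) = σ i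

infixr 5 _∷ˢ_

-- Conventions for indeterminates (A = Fin n):
--   A ∪ {X,Y} = Fin (2+n):  zero = X, suc zero = Y, suc (suc i) = A_i
--   A ∪ {Y}   = Fin (1+n):  zero = Y, suc i = A_i

IsGreatestSolution : ∀ {k} → (Poly k → Poly k) → Poly k → Set
IsGreatestSolution f x =
  Antichain x × x ≈ f x × (∀ y → Antichain y → y ≈ f y → y ≤ x)

IsGreatestSolution₂ : ∀ {k} → (Poly k → Poly k → Poly k) → (Poly k → Poly k → Poly k)
  → Poly k → Poly k → Set
IsGreatestSolution₂ f g x y =
  Antichain x × Antichain y × x ≈ f x y × y ≈ g x y ×
  (∀ x′ y′ → Antichain x′ → Antichain y′ → x′ ≈ f x′ y′ → y′ ≈ g x′ y′ →
     x′ ≤ x × y′ ≤ y)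

{-# OPTIONS --safe #-}

-- In S^∞ the greatest solution of X = P(X) has a closed form: writing
-- P(X) = c + Σ aᵢ X^{kᵢ} with all kᵢ ≥ 1, it is c + r^∞ where r = Σ aᵢ.  Being
-- given by semiring operations and ∞-powers, it commutes with substitution,
-- and it dominates every x with x ≤ P(x).  Hence H(y) is the greatest solution
-- of X = P(X,y) for every y, and if (x,y) solves the system then x ≤ H(y) and
-- so y ≤ Q(x,y) ≤ Q(H(y),y), which gives y ≤ b and x ≤ H(y) ≤ H(b).

module Submission where

open import Defs
open import Algebra.Bundles using (CommutativeMonoid)
import Algebra.Properties.CommutativeSemigroup as CommutativeSemigroupProperties
open import Data.Bool using (Bool; true; false; T; _∧_; not)
open import Data.Bool.ListAction using (any)
open import Data.Bool.Properties using (T?; T-∧)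
open import Data.Fin using (Fin; zero; suc)
open import Data.List using ([]; _∷_; _++_; cartesianProductWith; deduplicateᵇ; filterᵇ)
import Data.List as List
open import Data.List.Membership.Propositional using (_∈_; find; lose)
open import Data.List.Membership.Propositional.Properties
  using (∈-++⁺ˡ; ∈-++⁺ʳ; ∈-++⁻; ∈-map⁺; ∈-map⁻; ∈-filter⁺; ∈-filter⁻; ∈-deduplicate⁻;
         ∈-cartesianProductWith⁺; ∈-cartesianProductWith⁻)
import Data.List.Membership.Setoid.Properties as SetoidMembership
open import Data.List.Relation.Unary.All as All using (All; []; _∷_)
open import Data.List.Relation.Unary.All.Properties using (all-filter)
open import Data.List.Relation.Unary.AllPairs as AllPairs using (AllPairs; []; _∷_)
import Data.List.Relation.Unary.AllPairs.Properties as AllPairs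
open import Data.List.Relation.Unary.Any using (here; there)
open import Data.List.Relation.Unary.Any.Properties using (any⁺; any⁻)
open import Data.Nat using (ℕ; zero; suc; _+_; _∸_; _<_; z≤n; s≤s) renaming (_≤_ to _≤ℕ_)
open import Data.Nat.Induction using (<-wellFounded)
open import Data.Nat.Properties
  using (≤-refl; ≤-trans; ≤-antisym; ≤ᵇ⇒≤; ≤⇒≤ᵇ; +-assoc; +-comm; +-mono-≤;
         +-monoʳ-<; m∸n≤m; m+n≤o⇒m≤o∸n)
open import Data.Product using (_×_; _,_; ∃; ∃₂; proj₁; proj₂; swap)
open import Data.Sum using (_⊎_; inj₁; inj₂)
open import Data.Vec as Vec using ([]; _∷_)
open import Data.Vec.Properties using (zipWith-assoc; zipWith-comm; zipWith-identityˡ)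
open import Data.Vec.Relation.Binary.Pointwise.Inductive as Pointwise using ([]; _∷_)
open import Function using (_∘_; _∘₂_)
open import Function.Bundles using (Equivalence)
open import Induction.WellFounded using (Acc; acc)
open import Level using (0ℓ)
open import Relation.Binary.Bundles using (Poset)
open import Relation.Binary.Structures using (IsEquivalence)
import Relation.Binary.Reasoning.PartialOrder as PosetReasoning
open import Relation.Binary.PropositionalEquality
  using (_≡_; refl; sym; trans; cong; cong₂; subst; setoid)
open import Relation.Nullary using (¬_; yes; no; contradiction; ¬?)

private
  variable
    k j l : ℕ
    m p q u v : Monomial k
    a b c d : Poly k

-- Exponents

≤∞-refl : ∀ {e} → e ≤∞ e
≤∞-refl {fin n} = fin≤fin ≤-refl
≤∞-refl {∞}     = ∞ ≤∞∞

≤∞-trans : ∀ {e f g} → e ≤∞ f → f ≤∞ g → e ≤∞ g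
≤∞-trans (fin≤fin r) (fin≤fin s) = fin≤fin (≤-trans r s)
≤∞-trans r           (_ ≤∞∞)     = _ ≤∞∞

≤∞-antisym : ∀ {e f} → e ≤∞ f → f ≤∞ e → e ≡ f
≤∞-antisym (fin≤fin r) (fin≤fin s) = cong fin (≤-antisym r s)
≤∞-antisym (_ ≤∞∞)     (_ ≤∞∞)     = refl

0≤∞ : ∀ e → fin 0 ≤∞ e
0≤∞ (fin n) = fin≤fin z≤n
0≤∞ ∞       = _ ≤∞∞

≤∞ᵇ⇒≤∞ : ∀ e f → T (e ≤∞ᵇ f) → e ≤∞ f
≤∞ᵇ⇒≤∞ (fin m) (fin n) t = fin≤fin (≤ᵇ⇒≤ m n t)
≤∞ᵇ⇒≤∞ (fin m) ∞       t = _ ≤∞∞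
≤∞ᵇ⇒≤∞ ∞       ∞       t = _ ≤∞∞

≤∞⇒≤∞ᵇ : ∀ {e f} → e ≤∞ f → T (e ≤∞ᵇ f)
≤∞⇒≤∞ᵇ (fin≤fin r)     = ≤⇒≤ᵇ r
≤∞⇒≤∞ᵇ (fin _ ≤∞∞)     = _
≤∞⇒≤∞ᵇ (∞ ≤∞∞)         = _

+∞-assoc : ∀ e f g → (e +∞ f) +∞ g ≡ e +∞ (f +∞ g)
+∞-assoc (fin m) (fin n) (fin o) = cong fin (+-assoc m n o)
+∞-assoc (fin m) (fin n) ∞       = refl
+∞-assoc (fin m) ∞       g       = refl
+∞-assoc ∞       f       g       = refl

+∞-comm : ∀ e f → e +∞ f ≡ f +∞ e
+∞-comm (fin m) (fin n) = cong fin (+-comm m n)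
+∞-comm (fin m) ∞       = refl
+∞-comm ∞       (fin n) = refl
+∞-comm ∞       ∞       = refl

+∞-identityˡ : ∀ e → fin 0 +∞ e ≡ e
+∞-identityˡ (fin n) = refl
+∞-identityˡ ∞       = refl

+∞-mono : ∀ {e e′ f f′} → e ≤∞ e′ → f ≤∞ f′ → (e +∞ f) ≤∞ (e′ +∞ f′)
+∞-mono (fin≤fin r) (fin≤fin s) = fin≤fin (+-mono-≤ r s)
+∞-mono (fin≤fin r) (_ ≤∞∞)     = _ ≤∞∞
+∞-mono (_ ≤∞∞)     s           = _ ≤∞∞

-- The exponent map inside `mon∞` is an anonymous lambda. Reading it off a one-entry vector gives it
-- a name, with `mon∞ (e ∷ m)` definitionally equal to `sat e ∷ mon∞ m`.
sat : ℕ∞ → ℕ∞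
sat e = Vec.head (mon∞ (e ∷ []))

e≤sat : ∀ e → e ≤∞ sat e
e≤sat (fin zero)    = ≤∞-refl
e≤sat (fin (suc n)) = _ ≤∞∞
e≤sat ∞             = _ ≤∞∞

sat-mono : ∀ {e f} → e ≤∞ f → sat e ≤∞ sat f
sat-mono {fin zero}            r           = 0≤∞ _
sat-mono {fin (suc m)} {fin _} (fin≤fin (s≤s r)) = _ ≤∞∞
sat-mono {fin (suc m)} {∞}     r           = _ ≤∞∞
sat-mono {∞}           {∞}     r           = _ ≤∞∞

sat-+∞ : ∀ e f → sat (e +∞ f) ≡ sat e +∞ sat f
sat-+∞ (fin zero)    f             = trans (cong sat (+∞-identityˡ f)) (sym (+∞-identityˡ (sat f)))
sat-+∞ (fin (suc m)) (fin n)       = refl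
sat-+∞ (fin (suc m)) ∞             = refl
sat-+∞ ∞             f             = refl

sat-double : ∀ e → sat e +∞ sat e ≡ sat e
sat-double (fin zero)    = refl
sat-double (fin (suc n)) = refl
sat-double ∞             = refl

sat-idem : ∀ e → sat (sat e) ≡ sat e
sat-idem (fin zero)    = refl
sat-idem (fin (suc n)) = refl
sat-idem ∞             = refl

-- fin m ∸∞ ∞ is a junk value.
_∸∞_ : ℕ∞ → ℕ∞ → ℕ∞
fin m ∸∞ fin n = fin (m ∸ n)
fin m ∸∞ ∞     = fin 0
∞     ∸∞ f     = ∞

∸∞-≤∞ : ∀ e f → (e ∸∞ f) ≤∞ e
∸∞-≤∞ (fin m) (fin n) = fin≤fin (m∸n≤m m n)
∸∞-≤∞ (fin m) ∞       = 0≤∞ _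
∸∞-≤∞ ∞       f       = _ ≤∞∞

∸∞-residual : ∀ e f {g} → (e +∞ f) ≤∞ g → f ≤∞ (g ∸∞ e)
∸∞-residual (fin m) (fin n) (fin≤fin {n = o} r) =
  fin≤fin (m+n≤o⇒m≤o∸n n (subst (_≤ℕ o) (+-comm m n) r))
-- Here `g` is `∞`, and `∞ ∸∞ e` is `∞` for every `e`. An infinite `e` forces this case, so the junk
-- value of `_∸∞_` does not arise.
∸∞-residual e       f       (_ ≤∞∞)     = _ ≤∞∞

-- Monomials

⪰-refl : m ⪰ m
⪰-refl = Pointwise.refl ≤∞-refl

⪰-trans : m ⪰ p → p ⪰ q → m ⪰ q
⪰-trans = Pointwise.trans ≤∞-trans

⪰-reflexive : m ≡ p → m ⪰ p
⪰-reflexive refl = ⪰-refl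

⪰-antisym : m ⪰ p → p ⪰ m → m ≡ p
⪰-antisym []       []       = refl
⪰-antisym (r ∷ rs) (s ∷ ss) = cong₂ _∷_ (≤∞-antisym r s) (⪰-antisym rs ss)

⪰ᵇ⇒⪰ : (m p : Monomial k) → T (m ⪰ᵇ p) → m ⪰ p
⪰ᵇ⇒⪰ []      []      t = []
⪰ᵇ⇒⪰ (e ∷ m) (f ∷ p) t with r , rs ← Equivalence.to T-∧ t = ≤∞ᵇ⇒≤∞ e f r ∷ ⪰ᵇ⇒⪰ m p rs

⪰⇒⪰ᵇ : m ⪰ p → T (m ⪰ᵇ p)
⪰⇒⪰ᵇ []       = _
⪰⇒⪰ᵇ (r ∷ rs) = Equivalence.from T-∧ (≤∞⇒≤∞ᵇ r , ⪰⇒⪰ᵇ rs)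

==ₘ⇒≡ : (m p : Monomial k) → T (m ==ₘ p) → m ≡ p
==ₘ⇒≡ m p t with r , s ← Equivalence.to T-∧ t = ⪰-antisym (⪰ᵇ⇒⪰ m p r) (⪰ᵇ⇒⪰ p m s)

≡⇒==ₘ : m ≡ p → T (m ==ₘ p)
≡⇒==ₘ {m = m} refl = Equivalence.from (T-∧ {m ⪰ᵇ m}) (⪰⇒⪰ᵇ ⪰-refl′ , ⪰⇒⪰ᵇ ⪰-refl′)
  where ⪰-refl′ = ⪰-refl {m = m}

constMon-⪰ : (m : Monomial k) → constMon ⪰ m
constMon-⪰ []      = []
constMon-⪰ (e ∷ m) = 0≤∞ e ∷ constMon-⪰ m

*ₘ-mono : m ⪰ p → u ⪰ v → (m *ₘ u) ⪰ (p *ₘ v)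
*ₘ-mono = Pointwise.zipWith-cong +∞-mono

*ₘ-assoc : (m p q : Monomial k) → (m *ₘ p) *ₘ q ≡ m *ₘ (p *ₘ q)
*ₘ-assoc = zipWith-assoc +∞-assoc

*ₘ-comm : (m p : Monomial k) → m *ₘ p ≡ p *ₘ m
*ₘ-comm = zipWith-comm +∞-comm

*ₘ-identityˡ : (m : Monomial k) → constMon *ₘ m ≡ m
*ₘ-identityˡ = zipWith-identityˡ +∞-identityˡ

⪰-*ₘ : (m p : Monomial k) → m ⪰ (m *ₘ p)
⪰-*ₘ m p = ⪰-trans (⪰-reflexive (sym (trans (*ₘ-comm m constMon) (*ₘ-identityˡ m))))
                   (*ₘ-mono {m = m} ⪰-refl (constMon-⪰ p))

⪰-mon∞ : (m : Monomial k) → m ⪰ mon∞ m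
⪰-mon∞ []      = []
⪰-mon∞ (e ∷ m) = e≤sat e ∷ ⪰-mon∞ m

mon∞-mono : m ⪰ p → mon∞ m ⪰ mon∞ p
mon∞-mono []       = []
mon∞-mono (r ∷ rs) = sat-mono r ∷ mon∞-mono rs

mon∞-*ₘ : (m p : Monomial k) → mon∞ (m *ₘ p) ≡ mon∞ m *ₘ mon∞ p
mon∞-*ₘ []      []      = refl
mon∞-*ₘ (e ∷ m) (f ∷ p) = cong₂ _∷_ (sat-+∞ e f) (mon∞-*ₘ m p)

mon∞-double : (m : Monomial k) → mon∞ m *ₘ mon∞ m ≡ mon∞ m
mon∞-double []      = refl
mon∞-double (e ∷ m) = cong₂ _∷_ (sat-double e) (mon∞-double m)

mon∞-idem : (m : Monomial k) → mon∞ (mon∞ m) ≡ mon∞ m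
mon∞-idem []      = refl
mon∞-idem (e ∷ m) = cong₂ _∷_ (sat-idem e) (mon∞-idem m)

mon∞-constMon : ∀ k → mon∞ (constMon {k}) ≡ constMon
mon∞-constMon zero    = refl
mon∞-constMon (suc k) = cong (fin 0 ∷_) (mon∞-constMon k)

-- Division of monomials and finite degree

_∸ₘ_ : Monomial k → Monomial k → Monomial k
_∸ₘ_ = Vec.zipWith _∸∞_

∸ₘ-⪰ : (m p : Monomial k) → (m ∸ₘ p) ⪰ m
∸ₘ-⪰ []      []      = []
∸ₘ-⪰ (e ∷ m) (f ∷ p) = ∸∞-≤∞ e f ∷ ∸ₘ-⪰ m p

∸ₘ-residual : (p q : Monomial k) → (p *ₘ q) ⪰ m → q ⪰ (m ∸ₘ p)
∸ₘ-residual []      []      []       = []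
∸ₘ-residual (e ∷ p) (f ∷ q) (r ∷ rs) = ∸∞-residual e f r ∷ ∸ₘ-residual p q rs

-- Infinite exponents survive every subtraction, so only the finite ones can measure progress;
-- leaving out the others keeps the measure in `ℕ`.
finiteDegree : Monomial k → ℕ
finiteDegree []          = 0
finiteDegree (fin n ∷ m) = n + finiteDegree m
finiteDegree (∞     ∷ m) = finiteDegree m

finiteDegree-∸ₘ-≤ : (m p : Monomial k) → finiteDegree (m ∸ₘ p) ≤ℕ finiteDegree m
finiteDegree-∸ₘ-≤ []          []          = z≤n
finiteDegree-∸ₘ-≤ (fin n ∷ m) (fin o ∷ p) = +-mono-≤ (m∸n≤m n o) (finiteDegree-∸ₘ-≤ m p)
finiteDegree-∸ₘ-≤ (fin n ∷ m) (∞     ∷ p) = +-mono-≤ {0} {n} z≤n (finiteDegree-∸ₘ-≤ m p)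
finiteDegree-∸ₘ-≤ (∞     ∷ m) (_     ∷ p) = finiteDegree-∸ₘ-≤ m p

-- Either `p` has exponent 0 wherever `m` is finite, and then raising the positive exponents of `p`
-- to `∞` only affects places where `m` is already `∞`; or some positive exponent of `p` is
-- subtracted from a finite exponent of `m` that is at least as large.
finiteDegree-∸ₘ-< : p ⪰ m → mon∞ p ⪰ m ⊎ finiteDegree (m ∸ₘ p) < finiteDegree m
finiteDegree-∸ₘ-< [] = inj₁ []
finiteDegree-∸ₘ-< {p = e ∷ p} {m = ∞ ∷ m} (r ∷ rs) with finiteDegree-∸ₘ-< rs
... | inj₁ s = inj₁ (_ ≤∞∞ ∷ s)
... | inj₂ s = inj₂ s
finiteDegree-∸ₘ-< {p = fin zero ∷ p} {m = fin n ∷ m} (r ∷ rs) with finiteDegree-∸ₘ-< rs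
... | inj₁ s = inj₁ (r ∷ s)
... | inj₂ s = inj₂ (+-monoʳ-< n s)
finiteDegree-∸ₘ-< {p = fin (suc o) ∷ p} {m = fin (suc n) ∷ m} (fin≤fin (s≤s r) ∷ rs) =
  inj₂ (s≤s (+-mono-≤ (m∸n≤m n o) (finiteDegree-∸ₘ-≤ m p)))

-- Antichains and the order

_∈↓_ : Monomial k → Poly k → Set
m ∈↓ a = ∃ λ p → p ∈ a × p ⪰ m

-- Inclusion of the generated ideals; unlike _≤_ it makes sense for lists that
-- are not antichains.
record _≲_ (a b : Poly k) : Set where
  constructor ≲-intro
  field at : m ∈↓ a → m ∈↓ b
open _≲_

infix 4 _∈↓_ _≲_ _≃_

_≃_ : Poly k → Poly k → Set
a ≃ b = a ≲ b × b ≲ a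

∈⇒∈↓ : m ∈ a → m ∈↓ a
∈⇒∈↓ m∈a = _ , m∈a , ⪰-refl

∈↓-resp-⪰ : p ⪰ m → p ∈↓ a → m ∈↓ a
∈↓-resp-⪰ r (q , q∈a , s) = q , q∈a , ⪰-trans s r

generators-≲ : (∀ {m} → m ∈ a → m ∈↓ b) → a ≲ b
generators-≲ f .at (p , p∈a , r) = ∈↓-resp-⪰ r (f p∈a)

≲-refl : a ≲ a
≲-refl .at z = z

≲-trans : a ≲ b → b ≲ c → a ≲ c
≲-trans r s .at z = s .at (r .at z)

≃-refl : a ≃ a
≃-refl = ≲-refl , ≲-refl

≃-sym : a ≃ b → b ≃ a
≃-sym = swap

≃-trans : a ≃ b → b ≃ c → a ≃ c
≃-trans (r , r′) (s , s′) = ≲-trans r s , ≲-trans s′ r′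

≃-isEquivalence : IsEquivalence (_≃_ {k})
≃-isEquivalence = record { refl = ≃-refl ; sym = ≃-sym ; trans = ≃-trans }

≲-poset : ℕ → Poset 0ℓ 0ℓ 0ℓ
≲-poset k = record
  { Carrier = Poly k ; _≈_ = _≃_ ; _≤_ = _≲_
  ; isPartialOrder = record
    { isPreorder = record
      { isEquivalence = ≃-isEquivalence ; reflexive = proj₁ ; trans = ≲-trans }
    ; antisym = _,_ } }

module ≲-Reasoning {k} = PosetReasoning (≲-poset k)

-- Maximal monomials of a finite list

Undominated : Poly k → Monomial k → Set
Undominated L m = ∀ {p} → p ∈ L → p ⪰ m → p ≡ m

-- The list shrinks in the recursion while `m` stays fixed, so `m` cannot be assumed to lie in `L`;
-- hence the alternative `p ≡ m`.
maximalAbove : (L : Poly k) (m : Monomial k) →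
  ∃ λ p → (p ≡ m ⊎ p ∈ L) × p ⪰ m × Undominated L p
maximalAbove []      m = m , inj₁ refl , ⪰-refl , λ ()
maximalAbove (q ∷ L) m with p , p∈ , p⪰m , undom ← maximalAbove L m | T? (q ⪰ᵇ p)
-- The head `q` replaces `p`. Any `r` in the tail above `q` is also above `p`, hence equal to `p`,
-- hence below `q`.
... | yes t = q , inj₂ (here refl) , ⪰-trans (⪰ᵇ⇒⪰ q p t) p⪰m , λ
  { (here refl) _  → refl
  ; (there r∈L) r⪰q → ⪰-antisym r⪰q
      (subst (q ⪰_) (sym (undom r∈L (⪰-trans r⪰q (⪰ᵇ⇒⪰ q p t)))) (⪰ᵇ⇒⪰ q p t)) }
... | no ¬t = p , weaken p∈ , p⪰m , λ
  { (here refl) q⪰p → contradiction (⪰⇒⪰ᵇ q⪰p) ¬t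
  ; (there r∈L) r⪰p → undom r∈L r⪰p }
  where
  weaken : ∀ {p} → p ≡ m ⊎ p ∈ L → p ≡ m ⊎ p ∈ q ∷ L
  weaken (inj₁ e) = inj₁ e
  weaken (inj₂ i) = inj₂ (there i)

dominatesᵇ : Monomial k → Monomial k → Bool
dominatesᵇ m p = (p ⪰ᵇ m) ∧ not (p ==ₘ m)

T-not⁻ : ∀ {t} → T (not t) → ¬ T t
T-not⁻ {false} _ ()

T-not⁺ : ∀ {t} → ¬ T t → T (not t)
T-not⁺ {false} _ = _
T-not⁺ {true}  f = f _

undominatedᵇ⁺ : (L : Poly k) → Undominated L m → T (not (any (dominatesᵇ m) L))
undominatedᵇ⁺ L undom = T-not⁺ λ t →
  let p , p∈L , s = find (any⁻ _ L t)
      p⪰m , p≢m   = Equivalence.to T-∧ s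
  in T-not⁻ p≢m (≡⇒==ₘ (undom p∈L (⪰ᵇ⇒⪰ _ _ p⪰m)))

undominatedᵇ⁻ : (L : Poly k) → T (not (any (dominatesᵇ m) L)) → Undominated L m
undominatedᵇ⁻ {m = m} L t {p} p∈L p⪰m with T? (p ==ₘ m)
... | yes e = ==ₘ⇒≡ p m e
... | no ¬e = contradiction
  (any⁺ _ (lose p∈L (Equivalence.from T-∧ (⪰⇒⪰ᵇ p⪰m , T-not⁺ ¬e)))) (T-not⁻ t)

module _ (L : Poly k) where

  private
    keep : Monomial k → Bool
    keep m = not (any (dominatesᵇ m) L)

  ∈-Maximals⁺ : m ∈ L → Undominated L m → m ∈ Maximals L
  ∈-Maximals⁺ m∈L undom =
    -- Deduplication keeps one representative of each class of `_==ₘ_`; since `_==ₘ_` implies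
    -- equality, that representative is `m` itself.
    SetoidMembership.∈-deduplicate⁺ (setoid _) (T? ∘₂ _==ₘ_)
      (λ t r → trans r (sym (==ₘ⇒≡ _ _ t)))
      (∈-filter⁺ (T? ∘ keep) m∈L (undominatedᵇ⁺ L undom))

  ∈-Maximals⁻ : m ∈ Maximals L → m ∈ L × Undominated L m
  ∈-Maximals⁻ m∈ =
    let m∈L , t = ∈-filter⁻ (T? ∘ keep) (∈-deduplicate⁻ (T? ∘₂ _==ₘ_) (filterᵇ keep L) m∈)
    in m∈L , undominatedᵇ⁻ L t

  Maximals-≃ : Maximals L ≃ L
  Maximals-≃ = generators-≲ (∈⇒∈↓ ∘ proj₁ ∘ ∈-Maximals⁻) , generators-≲ above
    where
    above : m ∈ L → m ∈↓ Maximals L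
    above {m} m∈L with maximalAbove L m
    ... | p , inj₁ refl , p⪰m , undom = p , ∈-Maximals⁺ m∈L undom , p⪰m
    ... | p , inj₂ p∈L  , p⪰m , undom = p , ∈-Maximals⁺ p∈L undom , p⪰m

deduplicateᵇ-distinct : (L : Poly k) → AllPairs (λ m p → ¬ T (m ==ₘ p)) (deduplicateᵇ _==ₘ_ L)
deduplicateᵇ-distinct []      = []
deduplicateᵇ-distinct (m ∷ L) =
  all-filter (¬? ∘ T? ∘ (m ==ₘ_)) (deduplicateᵇ _==ₘ_ L) ∷
  AllPairs.filter⁺ (¬? ∘ T? ∘ (m ==ₘ_)) (deduplicateᵇ-distinct L)

-- Comparable undominated monomials are equal. `Antichain` compares list positions and so also
-- forbids repetitions, which is where deduplication enters.
Maximals-antichain : (L : Poly k) → Antichain (Maximals L)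
Maximals-antichain L = go (All.tabulate (∈-Maximals⁻ L)) (deduplicateᵇ-distinct _)
  where
  go : ∀ {xs} → All (λ m → m ∈ L × Undominated L m) xs →
       AllPairs (λ m p → ¬ T (m ==ₘ p)) xs → Antichain xs
  go []                     []           = []
  go ((m∈L , undom) ∷ rest) (m≠ ∷ pairs) =
    All.zipWith (λ { ((p∈L , undom′) , ≠) →
      (λ m⪰p → ≠ (≡⇒==ₘ (undom′ m∈L m⪰p))) ,
      (λ p⪰m → ≠ (≡⇒==ₘ (sym (undom p∈L p⪰m)))) }) (rest , m≠) ∷ go rest pairs

antichain-≡ : Antichain a → m ∈ a → p ∈ a → m ⪰ p → m ≡ p
antichain-≡ (_  ∷ _)  (here refl) (here refl) r = refl
antichain-≡ (ne ∷ _)  (here refl) (there p∈)  r = contradiction r (proj₁ (All.lookup ne p∈))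
antichain-≡ (ne ∷ _)  (there m∈)  (here refl) r = contradiction r (proj₂ (All.lookup ne m∈))
antichain-≡ (_  ∷ ac) (there m∈)  (there p∈)  r = antichain-≡ ac m∈ p∈ r

-- Going from `m` up to some `p` in `b` and on to some `q` in `a` must return to `m` because `a` is
-- an antichain; so `p` is squeezed to `m`. An antichain is thus determined by its ideal.
≲-antichain-∈ : Antichain a → a ≲ b → b ≲ a → m ∈ a → m ∈ b
≲-antichain-∈ ac r s m∈a with p , p∈b , p⪰m ← r .at (∈⇒∈↓ m∈a)
  with q , q∈a , q⪰p ← s .at (∈⇒∈↓ p∈b)
  with refl ← antichain-≡ ac q∈a m∈a (⪰-trans q⪰p p⪰m) = subst (_∈ _) (⪰-antisym p⪰m q⪰p) p∈b

≃⇒≈ : Antichain a → Antichain b → a ≃ b → a ≈ b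
≃⇒≈ aca acb (r , s) m = ≲-antichain-∈ aca r s , ≲-antichain-∈ acb s r

≈⇒≃ : a ≈ b → a ≃ b
≈⇒≃ e = generators-≲ (λ i → ∈⇒∈↓ (proj₁ (e _) i)) , generators-≲ (λ i → ∈⇒∈↓ (proj₂ (e _) i))

-- The semiring operations

a≲a⊕b : (a b : Poly k) → a ≲ a ⊕ b
a≲a⊕b a b = ≲-trans (generators-≲ λ m∈a → ∈⇒∈↓ (∈-++⁺ˡ m∈a)) (proj₂ (Maximals-≃ (a ++ b)))

b≲a⊕b : (a b : Poly k) → b ≲ a ⊕ b
b≲a⊕b a b = ≲-trans (generators-≲ λ m∈b → ∈⇒∈↓ (∈-++⁺ʳ a m∈b)) (proj₂ (Maximals-≃ (a ++ b)))

∈↓-⊕⁻ : (a b : Poly k) → m ∈↓ a ⊕ b → m ∈↓ a ⊎ m ∈↓ b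
∈↓-⊕⁻ a b z with p , p∈ , r ← proj₁ (Maximals-≃ (a ++ b)) .at z with ∈-++⁻ a p∈
... | inj₁ i = inj₁ (p , i , r)
... | inj₂ i = inj₂ (p , i , r)

⊕-least : a ≲ c → b ≲ c → a ⊕ b ≲ c
⊕-least {a = a} {b = b} r s .at z with ∈↓-⊕⁻ a b z
... | inj₁ i = r .at i
... | inj₂ i = s .at i

⊕-mono : a ≲ b → c ≲ d → a ⊕ c ≲ b ⊕ d
⊕-mono {b = b} {d = d} r s = ⊕-least (≲-trans r (a≲a⊕b b d)) (≲-trans s (b≲a⊕b b d))

⊕-monoʳ : (a : Poly k) → b ≲ c → a ⊕ b ≲ a ⊕ c
⊕-monoʳ a = ⊕-mono (≲-refl {a = a})

⊕-cong : a ≃ b → c ≃ d → a ⊕ c ≃ b ⊕ d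
⊕-cong (r , r′) (s , s′) = ⊕-mono r s , ⊕-mono r′ s′

≤⇒≲ : a ≤ b → a ≲ b
≤⇒≲ {a = a} {b = b} e = ≲-trans (a≲a⊕b a b) (proj₁ (≈⇒≃ e))

≲⇒≤ : Antichain b → a ≲ b → a ≤ b
≲⇒≤ {b = b} {a = a} acb r =
  ≃⇒≈ (Maximals-antichain (a ++ b)) acb (⊕-least r (≲-refl {a = b}) , b≲a⊕b a b)

𝟘-least : (a : Poly k) → 𝟘 ≲ a
𝟘-least a = generators-≲ λ ()

-- This is absorption: the constant monomial has the least exponents and so dominates everything.
𝟙-greatest : (a : Poly k) → a ≲ 𝟙
𝟙-greatest a .at {m} _ = constMon , here refl , constMon-⪰ m

∈↓-⊗⁺ : u ∈↓ a → v ∈↓ b → (u *ₘ v) ⪰ m → m ∈↓ a ⊗ b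
∈↓-⊗⁺ {a = a} {b = b} (p , p∈a , r) (q , q∈b , s) t =
  proj₂ (Maximals-≃ (cartesianProductWith _*ₘ_ a b)) .at
    (p *ₘ q , ∈-cartesianProductWith⁺ _*ₘ_ p∈a q∈b , ⪰-trans (*ₘ-mono r s) t)

∈↓-⊗⁻ : ∀ a b → m ∈↓ a ⊗ b → ∃₂ λ u v → u ∈ a × v ∈ b × (u *ₘ v) ⪰ m
∈↓-⊗⁻ a b z with p , p∈ , r ← proj₁ (Maximals-≃ (cartesianProductWith _*ₘ_ a b)) .at z
  with u , v , u∈a , v∈b , refl ← ∈-cartesianProductWith⁻ _*ₘ_ a b p∈ = u , v , u∈a , v∈b , r

⊗-mono : a ≲ b → c ≲ d → a ⊗ c ≲ b ⊗ d
⊗-mono {a = a} {c = c} r s .at z with u , v , u∈a , v∈c , t ← ∈↓-⊗⁻ a c z =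
  ∈↓-⊗⁺ (r .at (∈⇒∈↓ u∈a)) (s .at (∈⇒∈↓ v∈c)) t

⊗-monoˡ : (c : Poly k) → a ≲ b → a ⊗ c ≲ b ⊗ c
⊗-monoˡ c r = ⊗-mono r (≲-refl {a = c})

⊗-monoʳ : (a : Poly k) → b ≲ c → a ⊗ b ≲ a ⊗ c
⊗-monoʳ a = ⊗-mono (≲-refl {a = a})

⊗-cong : a ≃ b → c ≃ d → a ⊗ c ≃ b ⊗ d
⊗-cong (r , r′) (s , s′) = ⊗-mono r s , ⊗-mono r′ s′

⊗-congʳ : (a : Poly k) → b ≃ c → a ⊗ b ≃ a ⊗ c
⊗-congʳ a = ⊗-cong (≃-refl {a = a})

⊗-comm-≲ : (a b : Poly k) → a ⊗ b ≲ b ⊗ a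
⊗-comm-≲ a b .at z with u , v , u∈a , v∈b , t ← ∈↓-⊗⁻ a b z =
  ∈↓-⊗⁺ (∈⇒∈↓ v∈b) (∈⇒∈↓ u∈a) (⪰-trans (⪰-reflexive (*ₘ-comm v u)) t)

⊗-comm : (a b : Poly k) → a ⊗ b ≃ b ⊗ a
⊗-comm a b = ⊗-comm-≲ a b , ⊗-comm-≲ b a

⊗-assoc-≲ : (a b c : Poly k) → (a ⊗ b) ⊗ c ≲ a ⊗ (b ⊗ c)
⊗-assoc-≲ a b c .at z with uv , w , uv∈ , w∈c , t ← ∈↓-⊗⁻ (a ⊗ b) c z
  with u , v , u∈a , v∈b , s ← ∈↓-⊗⁻ a b (∈⇒∈↓ uv∈) =
  ∈↓-⊗⁺ (∈⇒∈↓ u∈a) (∈↓-⊗⁺ (∈⇒∈↓ v∈b) (∈⇒∈↓ w∈c) ⪰-refl)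
    (⪰-trans (⪰-reflexive (sym (*ₘ-assoc u v w))) (⪰-trans (*ₘ-mono s ⪰-refl) t))

⊗-assoc : (a b c : Poly k) → (a ⊗ b) ⊗ c ≃ a ⊗ (b ⊗ c)
-- The converse is the first inequality for the reversed factors, conjugated by commutativity.
⊗-assoc a b c = ⊗-assoc-≲ a b c , (begin
  a ⊗ (b ⊗ c)  ≤⟨ ⊗-monoʳ a (⊗-comm-≲ b c) ⟩
  a ⊗ (c ⊗ b)  ≤⟨ ⊗-comm-≲ a (c ⊗ b) ⟩
  (c ⊗ b) ⊗ a  ≤⟨ ⊗-assoc-≲ c b a ⟩
  c ⊗ (b ⊗ a)  ≤⟨ ⊗-monoʳ c (⊗-comm-≲ b a) ⟩
  c ⊗ (a ⊗ b)  ≤⟨ ⊗-comm-≲ c (a ⊗ b) ⟩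
  (a ⊗ b) ⊗ c  ∎)
  where open ≲-Reasoning

⊗-≲ʳ : (a b : Poly k) → a ⊗ b ≲ b
⊗-≲ʳ a b .at z with u , v , u∈a , v∈b , t ← ∈↓-⊗⁻ a b z =
  v , v∈b , ⪰-trans (⪰-trans (⪰-*ₘ v u) (⪰-reflexive (*ₘ-comm v u))) t

⊗-≲ˡ : (a b : Poly k) → a ⊗ b ≲ a
⊗-≲ˡ a b = ≲-trans (⊗-comm-≲ a b) (⊗-≲ʳ b a)

⊗-identityˡ : (a : Poly k) → 𝟙 ⊗ a ≃ a
⊗-identityˡ a = ⊗-≲ʳ 𝟙 a , ≲-intro λ {m} z →
  ∈↓-⊗⁺ {a = 𝟙} (∈⇒∈↓ (here refl)) z (⪰-reflexive (*ₘ-identityˡ m))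

⊗-identityʳ : (a : Poly k) → a ⊗ 𝟙 ≃ a
⊗-identityʳ a = ≃-trans (⊗-comm a 𝟙) (⊗-identityˡ a)

⊗-commutativeMonoid : ℕ → CommutativeMonoid 0ℓ 0ℓ
⊗-commutativeMonoid k = record
  { Carrier = Poly k ; _≈_ = _≃_ ; _∙_ = _⊗_ ; ε = 𝟙
  ; isCommutativeMonoid = record
    { isMonoid = record
      { isSemigroup = record
        { isMagma = record { isEquivalence = ≃-isEquivalence ; ∙-cong = ⊗-cong }
        ; assoc = ⊗-assoc }
      ; identity = ⊗-identityˡ , ⊗-identityʳ }
    ; comm = ⊗-comm } }

⊗-interchange : (a b c d : Poly k) → (a ⊗ b) ⊗ (c ⊗ d) ≃ (a ⊗ c) ⊗ (b ⊗ d)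
⊗-interchange {k} = CommutativeSemigroupProperties.interchange
  (CommutativeMonoid.commutativeSemigroup (⊗-commutativeMonoid k))

⊗-distribˡ-⊕-≲ : (a b c : Poly k) → a ⊗ (b ⊕ c) ≲ (a ⊗ b) ⊕ (a ⊗ c)
⊗-distribˡ-⊕-≲ a b c .at z
  with u , v , u∈a , v∈ , t ← ∈↓-⊗⁻ a (b ⊕ c) z with ∈↓-⊕⁻ b c (∈⇒∈↓ v∈)
... | inj₁ i = a≲a⊕b (a ⊗ b) (a ⊗ c) .at (∈↓-⊗⁺ (∈⇒∈↓ u∈a) i t)
... | inj₂ i = b≲a⊕b (a ⊗ b) (a ⊗ c) .at (∈↓-⊗⁺ (∈⇒∈↓ u∈a) i t)

-- Powers

infix 8 _^∞
_^∞ : Poly k → Poly k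
a ^∞ = pow a ∞

∈↓-^∞⁺ : u ∈↓ a → mon∞ u ⪰ m → m ∈↓ a ^∞
∈↓-^∞⁺ {a = a} (p , p∈a , r) s = proj₂ (Maximals-≃ (List.map mon∞ a)) .at
  (mon∞ p , ∈-map⁺ mon∞ p∈a , ⪰-trans (mon∞-mono r) s)

∈↓-^∞⁻ : (a : Poly k) → m ∈↓ a ^∞ → ∃ λ u → u ∈ a × mon∞ u ⪰ m
∈↓-^∞⁻ a z with p , p∈ , r ← proj₁ (Maximals-≃ (List.map mon∞ a)) .at z
  with u , u∈a , refl ← ∈-map⁻ mon∞ p∈ = u , u∈a , r

^∞-mono : a ≲ b → a ^∞ ≲ b ^∞
^∞-mono {a = a} r .at z with u , u∈a , s ← ∈↓-^∞⁻ a z = ∈↓-^∞⁺ (r .at (∈⇒∈↓ u∈a)) s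

^∞-≲ : (a : Poly k) → a ^∞ ≲ a
^∞-≲ a .at z with u , u∈a , s ← ∈↓-^∞⁻ a z = u , u∈a , ⪰-trans (⪰-mon∞ u) s

-- Saturated exponents are 0 or `∞`, and both are idempotent under addition. Iterating this places
-- `a ^∞` below every power of `a`.
^∞-double : (a : Poly k) → a ^∞ ≲ a ^∞ ⊗ a ^∞
^∞-double a .at z with u , u∈a , s ← ∈↓-^∞⁻ a z =
  ∈↓-⊗⁺ w w (⪰-trans (⪰-reflexive (mon∞-double u)) s)
  where w = ∈↓-^∞⁺ (∈⇒∈↓ u∈a) ⪰-refl

^∞-idem : (a : Poly k) → a ^∞ ≲ (a ^∞) ^∞
^∞-idem a .at z with u , u∈a , s ← ∈↓-^∞⁻ a z =
  ∈↓-^∞⁺ (∈↓-^∞⁺ (∈⇒∈↓ u∈a) ⪰-refl) (⪰-trans (⪰-reflexive (mon∞-idem u)) s)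

^∞-⊗ : (a b : Poly k) → (a ⊗ b) ^∞ ≃ a ^∞ ⊗ b ^∞
^∞-⊗ a b = ≲-intro to , ≲-intro from
  where
  to : m ∈↓ (a ⊗ b) ^∞ → m ∈↓ a ^∞ ⊗ b ^∞
  to z with w , w∈ , s ← ∈↓-^∞⁻ (a ⊗ b) z with u , v , u∈a , v∈b , t ← ∈↓-⊗⁻ a b (∈⇒∈↓ w∈) =
    ∈↓-⊗⁺ (∈↓-^∞⁺ (∈⇒∈↓ u∈a) ⪰-refl) (∈↓-^∞⁺ (∈⇒∈↓ v∈b) ⪰-refl)
      (⪰-trans (⪰-reflexive (sym (mon∞-*ₘ u v))) (⪰-trans (mon∞-mono t) s))
  from : m ∈↓ a ^∞ ⊗ b ^∞ → m ∈↓ (a ⊗ b) ^∞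
  from z with u′ , v′ , u∈ , v∈ , s ← ∈↓-⊗⁻ (a ^∞) (b ^∞) z
    with u , u∈a , r ← ∈↓-^∞⁻ a (∈⇒∈↓ u∈) | v , v∈b , t ← ∈↓-^∞⁻ b (∈⇒∈↓ v∈) =
    ∈↓-^∞⁺ (∈↓-⊗⁺ (∈⇒∈↓ u∈a) (∈⇒∈↓ v∈b) ⪰-refl)
      (⪰-trans (⪰-reflexive (mon∞-*ₘ u v)) (⪰-trans (*ₘ-mono r t) s))

𝟙-^∞ : 𝟙 {k} ≃ 𝟙 ^∞
𝟙-^∞ = ≲-intro (λ {m} _ → ∈↓-^∞⁺ (∈⇒∈↓ (here refl))
  (⪰-trans (⪰-reflexive (mon∞-constMon _)) (constMon-⪰ m))) , 𝟙-greatest (𝟙 ^∞)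

^∞-≲-pow : ∀ (a : Poly k) e → a ^∞ ≲ pow a e
^∞-≲-pow a (fin zero)    = 𝟙-greatest (a ^∞)
^∞-≲-pow a (fin (suc n)) = ≲-trans (^∞-double a) (⊗-mono (^∞-≲ a) (^∞-≲-pow a (fin n)))
^∞-≲-pow a ∞             = ≲-refl {a = a ^∞}

pow-mono : ∀ e → a ≲ b → pow a e ≲ pow b e
pow-mono (fin zero)    r = ≲-refl {a = 𝟙}
pow-mono (fin (suc n)) r = ⊗-mono r (pow-mono (fin n) r)
pow-mono ∞             r = ^∞-mono r

pow-antitone : ∀ {e f} (a : Poly k) → e ≤∞ f → pow a f ≲ pow a e
pow-antitone {f = f} a (fin≤fin z≤n) = 𝟙-greatest (pow a f)
pow-antitone a (fin≤fin (s≤s r))     = ⊗-monoʳ a (pow-antitone a (fin≤fin r))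
pow-antitone a (e ≤∞∞)               = ^∞-≲-pow a e

pow-⊗-^∞ : ∀ (a : Poly k) e → a ^∞ ≃ pow a e ⊗ a ^∞
pow-⊗-^∞ a e =
  ≲-trans (^∞-double a) (⊗-monoˡ (a ^∞) (^∞-≲-pow a e)) , ⊗-≲ʳ (pow a e) (a ^∞)

pow-+∞ : ∀ (a : Poly k) e f → pow a (e +∞ f) ≃ pow a e ⊗ pow a f
pow-+∞ a (fin zero)    (fin n) = ≃-sym (⊗-identityˡ (powℕ a n))
pow-+∞ a (fin (suc m)) (fin n) = ≃-trans
  (⊗-congʳ a (pow-+∞ a (fin m) (fin n))) (≃-sym (⊗-assoc a (powℕ a m) (powℕ a n)))
pow-+∞ a (fin m)       ∞       = pow-⊗-^∞ a (fin m)
pow-+∞ a ∞             f       = ≃-trans (pow-⊗-^∞ a f) (⊗-comm (pow a f) (a ^∞))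

pow-sat : ∀ (a : Poly k) e → pow a (sat e) ≃ (pow a e) ^∞
pow-sat a (fin zero)      = 𝟙-^∞
-- For a positive exponent the power lies between `a ^∞` and `a`, and taking the `∞`-power closes
-- this gap.
pow-sat a e@(fin (suc n)) =
  ≲-trans (^∞-idem a) (^∞-mono (^∞-≲-pow a e)) , ^∞-mono (⊗-≲ˡ a (powℕ a n))
pow-sat a ∞               = ^∞-idem a , ^∞-≲ (a ^∞)

^∞-≲-pow-^∞ : ∀ (a : Poly k) e → a ^∞ ≲ pow (a ^∞) e
^∞-≲-pow-^∞ a e = ≲-trans (^∞-idem a) (^∞-≲-pow (a ^∞) e)

-- This is full continuity of the semiring in the only form needed.  If
-- m ∈↓ a ⊗ x through a generator p of a, then either p^∞ already lies above m
-- or m ∸ₘ p ∈↓ x has smaller finite degree.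
^∞-induction : (x c a : Poly k) → x ≲ c ⊕ a ⊗ x → x ≲ c ⊕ a ^∞
^∞-induction x c a step .at {m} = go m (<-wellFounded _)
  where
  go : ∀ m → Acc _<_ (finiteDegree m) → m ∈↓ x → m ∈↓ c ⊕ a ^∞
  go m (acc rec) z with ∈↓-⊕⁻ c (a ⊗ x) (step .at z)
  ... | inj₁ i = a≲a⊕b c (a ^∞) .at i
  ... | inj₂ i with p , q , p∈a , q∈x , t ← ∈↓-⊗⁻ a x i
    with finiteDegree-∸ₘ-< (⪰-trans (⪰-*ₘ p q) t)
  ...   | inj₁ s = b≲a⊕b c (a ^∞) .at (∈↓-^∞⁺ (∈⇒∈↓ p∈a) s)
  -- The removed factor `p` need not be restored: `m ∸ₘ p` has smaller exponents than `m`, so an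
  -- ideal containing it contains `m`.
  ...   | inj₂ s = ∈↓-resp-⪰ (∸ₘ-⪰ m p)
    (go (m ∸ₘ p) (rec s) (q , q∈x , ∸ₘ-residual p q t))

-- Evaluation

private
  variable
    σ τ : Fin k → Poly j

-- By absorption larger exponents give smaller powers. Hence dominated monomials contribute nothing
-- to a value, and evaluation depends only on the ideal of its first argument.
evalMon-antitone : (σ : Fin k → Poly j) → p ⪰ q → evalMon q σ ≲ evalMon p σ
evalMon-antitone σ []       = ≲-refl {a = 𝟙}
evalMon-antitone σ (r ∷ rs) =
  ⊗-mono (pow-antitone (σ zero) r) (evalMon-antitone (σ ∘ suc) rs)

evalMon-mono : (p : Monomial k) → (∀ i → σ i ≲ τ i) → evalMon p σ ≲ evalMon p τ
evalMon-mono []      r = ≲-refl {a = 𝟙}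
evalMon-mono (e ∷ p) r = ⊗-mono (pow-mono e (r zero)) (evalMon-mono p (r ∘ suc))

evalMon-constMon : ∀ k (σ : Fin k → Poly j) → evalMon constMon σ ≃ 𝟙
evalMon-constMon zero    σ = ≃-refl {a = 𝟙}
evalMon-constMon (suc k) σ =
  ≃-trans (⊗-identityˡ (evalMon constMon (σ ∘ suc))) (evalMon-constMon k (σ ∘ suc))

evalMon-unitMon : (i : Fin k) (σ : Fin k → Poly j) → evalMon (unitMon i) σ ≃ σ i
evalMon-unitMon {suc k} zero    σ = ≃-trans
  (⊗-cong (⊗-identityʳ (σ zero)) (evalMon-constMon k (σ ∘ suc))) (⊗-identityʳ (σ zero))
evalMon-unitMon {suc k} (suc i) σ =
  ≃-trans (⊗-identityˡ (evalMon (unitMon i) (σ ∘ suc))) (evalMon-unitMon i (σ ∘ suc))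

evalMon-*ₘ : (p q : Monomial k) (σ : Fin k → Poly j) →
  evalMon (p *ₘ q) σ ≃ evalMon p σ ⊗ evalMon q σ
evalMon-*ₘ []      []      σ = ≃-sym (⊗-identityˡ 𝟙)
evalMon-*ₘ (e ∷ p) (f ∷ q) σ = ≃-trans
  (⊗-cong (pow-+∞ (σ zero) e f) (evalMon-*ₘ p q (σ ∘ suc)))
  (⊗-interchange (pow (σ zero) e) (pow (σ zero) f) (evalMon p (σ ∘ suc)) (evalMon q (σ ∘ suc)))

evalMon-mon∞ : (p : Monomial k) (σ : Fin k → Poly j) → evalMon (mon∞ p) σ ≃ (evalMon p σ) ^∞
evalMon-mon∞ []      σ = 𝟙-^∞
evalMon-mon∞ (e ∷ p) σ = ≃-trans
  (⊗-cong (pow-sat (σ zero) e) (evalMon-mon∞ p (σ ∘ suc)))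
  (≃-sym (^∞-⊗ (pow (σ zero) e) (evalMon p (σ ∘ suc))))

evalMon-≲-eval : (σ : Fin k → Poly j) → p ∈ a → evalMon p σ ≲ eval a σ
evalMon-≲-eval {a = p ∷ a} σ (here refl) = a≲a⊕b (evalMon p σ) (eval a σ)
evalMon-≲-eval {a = p ∷ a} σ (there q∈a) =
  ≲-trans (evalMon-≲-eval σ q∈a) (b≲a⊕b (evalMon p σ) (eval a σ))

evalMon-∈↓ : (σ : Fin k → Poly j) → p ∈↓ a → evalMon p σ ≲ eval a σ
evalMon-∈↓ σ (q , q∈a , r) = ≲-trans (evalMon-antitone σ r) (evalMon-≲-eval σ q∈a)

eval-least : (a : Poly k) (σ : Fin k → Poly j) → (∀ {p} → p ∈ a → evalMon p σ ≲ c) → eval a σ ≲ c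
eval-least {c = c} []      σ f = 𝟘-least c
eval-least         (p ∷ a) σ f = ⊕-least (f (here refl)) (eval-least a σ (f ∘ there))

∈↓-eval⁻ : (a : Poly k) (σ : Fin k → Poly j) → m ∈↓ eval a σ → ∃ λ p → p ∈ a × m ∈↓ evalMon p σ
∈↓-eval⁻ (p ∷ a) σ z with ∈↓-⊕⁻ (evalMon p σ) (eval a σ) z
... | inj₁ i = p , here refl , i
... | inj₂ i with q , q∈a , w ← ∈↓-eval⁻ a σ i = q , there q∈a , w

eval-antichain : (a : Poly k) (σ : Fin k → Poly j) → Antichain (eval a σ)
eval-antichain []      σ = []
eval-antichain (p ∷ a) σ = Maximals-antichain (evalMon p σ ++ eval a σ)

eval-monoˡ : (σ : Fin k → Poly j) → a ≲ b → eval a σ ≲ eval b σ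
eval-monoˡ {a = a} σ r = eval-least a σ λ p∈a → evalMon-∈↓ σ (r .at (∈⇒∈↓ p∈a))

eval-congˡ : (σ : Fin k → Poly j) → a ≃ b → eval a σ ≃ eval b σ
eval-congˡ σ (r , s) = eval-monoˡ σ r , eval-monoˡ σ s

eval-monoʳ : (a : Poly k) → (∀ i → σ i ≲ τ i) → eval a σ ≲ eval a τ
eval-monoʳ {σ = σ} {τ = τ} a r =
  eval-least a σ λ {p} p∈a → ≲-trans (evalMon-mono p r) (evalMon-≲-eval τ p∈a)

eval-congʳ : (a : Poly k) → (∀ i → σ i ≃ τ i) → eval a σ ≃ eval a τ
eval-congʳ a r = eval-monoʳ a (proj₁ ∘ r) , eval-monoʳ a (proj₂ ∘ r)

eval-var : (i : Fin k) (σ : Fin k → Poly j) → eval (var i) σ ≃ σ i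
eval-var i σ = ≃-trans (⊕-least (≲-refl {a = s}) (𝟘-least s) , a≲a⊕b s 𝟘) (evalMon-unitMon i σ)
  where s = evalMon (unitMon i) σ

eval-𝟙 : (σ : Fin k → Poly j) → eval 𝟙 σ ≃ 𝟙
eval-𝟙 {k} σ = 𝟙-greatest (eval 𝟙 σ) ,
  ≲-trans (proj₂ (evalMon-constMon k σ)) (a≲a⊕b (evalMon constMon σ) 𝟘)

eval-⊕ : (a b : Poly k) (σ : Fin k → Poly j) → eval (a ⊕ b) σ ≃ eval a σ ⊕ eval b σ
eval-⊕ a b σ = eval-least (a ⊕ b) σ to ,
  ⊕-least (eval-monoˡ σ (a≲a⊕b a b)) (eval-monoˡ σ (b≲a⊕b a b))
  where
  to : p ∈ a ⊕ b → evalMon p σ ≲ eval a σ ⊕ eval b σ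
  to p∈ with ∈↓-⊕⁻ a b (∈⇒∈↓ p∈)
  ... | inj₁ i = ≲-trans (evalMon-∈↓ σ i) (a≲a⊕b (eval a σ) (eval b σ))
  ... | inj₂ i = ≲-trans (evalMon-∈↓ σ i) (b≲a⊕b (eval a σ) (eval b σ))

eval-⊗ : (a b : Poly k) (σ : Fin k → Poly j) → eval (a ⊗ b) σ ≃ eval a σ ⊗ eval b σ
eval-⊗ a b σ = eval-least (a ⊗ b) σ to , ≲-intro from
  where
  to : p ∈ a ⊗ b → evalMon p σ ≲ eval a σ ⊗ eval b σ
  to {p} p∈ with u , v , u∈a , v∈b , r ← ∈↓-⊗⁻ a b (∈⇒∈↓ p∈) = begin
    evalMon p σ                ≤⟨ evalMon-antitone σ r ⟩
    evalMon (u *ₘ v) σ         ≈⟨ evalMon-*ₘ u v σ ⟩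
    evalMon u σ ⊗ evalMon v σ  ≤⟨ ⊗-mono (evalMon-≲-eval σ u∈a) (evalMon-≲-eval σ v∈b) ⟩
    eval a σ ⊗ eval b σ        ∎
    where open ≲-Reasoning
  from : m ∈↓ eval a σ ⊗ eval b σ → m ∈↓ eval (a ⊗ b) σ
  from z with u , v , u∈ , v∈ , r ← ∈↓-⊗⁻ (eval a σ) (eval b σ) z
    with p , p∈a , s ← ∈↓-eval⁻ a σ (∈⇒∈↓ u∈) | q , q∈b , t ← ∈↓-eval⁻ b σ (∈⇒∈↓ v∈) =
    evalMon-∈↓ σ (∈↓-⊗⁺ (∈⇒∈↓ p∈a) (∈⇒∈↓ q∈b) ⪰-refl) .at
      (proj₂ (evalMon-*ₘ p q σ) .at (∈↓-⊗⁺ s t r))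

-- The `∞`-power acts on each monomial separately, which reduces the claim to `evalMon-mon∞`. This
-- is why the closed form commutes with substitution.
eval-^∞ : (a : Poly k) (σ : Fin k → Poly j) → eval (a ^∞) σ ≃ (eval a σ) ^∞
eval-^∞ a σ = eval-least (a ^∞) σ to , ≲-intro from
  where
  to : p ∈ a ^∞ → evalMon p σ ≲ (eval a σ) ^∞
  to {p} p∈ with u , u∈a , r ← ∈↓-^∞⁻ a (∈⇒∈↓ p∈) = begin
    evalMon p σ          ≤⟨ evalMon-antitone σ r ⟩
    evalMon (mon∞ u) σ   ≈⟨ evalMon-mon∞ u σ ⟩
    (evalMon u σ) ^∞     ≤⟨ ^∞-mono (evalMon-≲-eval σ u∈a) ⟩
    (eval a σ) ^∞        ∎
    where open ≲-Reasoning
  from : m ∈↓ (eval a σ) ^∞ → m ∈↓ eval (a ^∞) σ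
  from z with u , u∈ , r ← ∈↓-^∞⁻ (eval a σ) z with p , p∈a , s ← ∈↓-eval⁻ a σ (∈⇒∈↓ u∈) =
    evalMon-∈↓ σ (∈↓-^∞⁺ (∈⇒∈↓ p∈a) ⪰-refl) .at
      (proj₂ (evalMon-mon∞ p σ) .at (∈↓-^∞⁺ s r))

eval-pow : ∀ (a : Poly k) e (σ : Fin k → Poly j) → eval (pow a e) σ ≃ pow (eval a σ) e
eval-pow a (fin zero)    σ = eval-𝟙 σ
eval-pow a (fin (suc n)) σ =
  ≃-trans (eval-⊗ a (powℕ a n) σ) (⊗-congʳ (eval a σ) (eval-pow a (fin n) σ))
eval-pow a ∞             σ = eval-^∞ a σ

eval-evalMon : (p : Monomial k) (σ : Fin k → Poly j) (τ : Fin j → Poly l) →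
  eval (evalMon p σ) τ ≃ evalMon p (λ i → eval (σ i) τ)
eval-evalMon []      σ τ = eval-𝟙 τ
eval-evalMon (e ∷ p) σ τ = ≃-trans (eval-⊗ (pow (σ zero) e) (evalMon p (σ ∘ suc)) τ)
  (⊗-cong (eval-pow (σ zero) e τ) (eval-evalMon p (σ ∘ suc) τ))

eval-eval : (a : Poly k) (σ : Fin k → Poly j) (τ : Fin j → Poly l) →
  eval (eval a σ) τ ≃ eval a (λ i → eval (σ i) τ)
eval-eval []      σ τ = ≃-refl {a = 𝟘}
eval-eval (p ∷ a) σ τ = ≃-trans (eval-⊕ (evalMon p σ) (eval a σ) τ)
  (⊕-cong (eval-evalMon p σ τ) (eval-eval a σ τ))

∷ˢ-mono : a ≲ b → (σ : Fin k → Poly j) → ∀ i → (a ∷ˢ σ) i ≲ (b ∷ˢ σ) i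
∷ˢ-mono r σ zero    = r
∷ˢ-mono r σ (suc i) = ≲-refl {a = σ i}

∷ˢ-cong : a ≃ b → (σ : Fin k → Poly j) → ∀ i → (a ∷ˢ σ) i ≃ (b ∷ˢ σ) i
∷ˢ-cong r σ zero    = r
∷ˢ-cong r σ (suc i) = ≃-refl {a = σ i}

-- Greatest solutions of one equation

constPart : Poly (suc k) → Poly k
constPart []                   = []
constPart ((fin zero ∷ p) ∷ P) = p ∷ constPart P
constPart (_ ∷ P)              = constPart P

-- The positive exponent of the leading indeterminate is forgotten, as it does not enter the closed
-- form. The outcome may contain comparable monomials, which does no harm to ideals.
coefficients : Poly (suc k) → Poly k
coefficients []                   = []
coefficients ((fin zero ∷ _) ∷ P) = coefficients P
coefficients ((_ ∷ p) ∷ P)        = p ∷ coefficients P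

-- The closed form is a polynomial in the coefficient indeterminates, so one formula can be
-- evaluated under every substitution.
greatest : Poly (suc k) → Poly k
greatest P = constPart P ⊕ coefficients P ^∞

constPart-∈ : (P : Poly (suc k)) → p ∈ constPart P → (fin 0 ∷ p) ∈ P
constPart-∈ ((fin zero    ∷ _) ∷ P) (here refl) = here refl
constPart-∈ ((fin zero    ∷ _) ∷ P) (there p∈)  = there (constPart-∈ P p∈)
constPart-∈ ((fin (suc _) ∷ _) ∷ P) p∈          = there (constPart-∈ P p∈)
constPart-∈ ((∞           ∷ _) ∷ P) p∈          = there (constPart-∈ P p∈)

coefficients-∈ : (P : Poly (suc k)) → p ∈ coefficients P → ∃ λ e → (e ∷ p) ∈ P
coefficients-∈ ((fin zero ∷ _) ∷ P) p∈ with e , i ← coefficients-∈ P p∈ = e , there i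
coefficients-∈ ((e@(fin (suc _)) ∷ _) ∷ P) (here refl) = e , here refl
coefficients-∈ ((fin (suc _) ∷ _) ∷ P) (there p∈) with e , i ← coefficients-∈ P p∈ = e , there i
coefficients-∈ ((∞ ∷ _) ∷ P) (here refl) = ∞ , here refl
coefficients-∈ ((∞ ∷ _) ∷ P) (there p∈) with e , i ← coefficients-∈ P p∈ = e , there i

∈-constPart : {P : Poly (suc k)} → (fin 0 ∷ p) ∈ P → p ∈ constPart P
∈-constPart (here refl) = here refl
∈-constPart {P = (fin zero    ∷ _) ∷ _} (there i) = there (∈-constPart i)
∈-constPart {P = (fin (suc _) ∷ _) ∷ _} (there i) = ∈-constPart i
∈-constPart {P = (∞           ∷ _) ∷ _} (there i) = ∈-constPart i

∈-coefficients : ∀ {e} {P : Poly (suc k)} → fin 1 ≤∞ e → (e ∷ p) ∈ P → p ∈ coefficients P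
∈-coefficients {e = fin (suc _)} r (here refl) = here refl
∈-coefficients {e = fin zero} (fin≤fin ()) (here refl)
∈-coefficients {e = ∞} r (here refl) = here refl
∈-coefficients {P = (fin zero    ∷ _) ∷ _} r (there i) = ∈-coefficients r i
∈-coefficients {P = (fin (suc _) ∷ _) ∷ _} r (there i) = there (∈-coefficients r i)
∈-coefficients {P = (∞           ∷ _) ∷ _} r (there i) = there (∈-coefficients r i)

-- The closed form under a substitution

module _ (P : Poly (suc k)) (σ : Fin k → Poly j) where

  private
    c₀ r₀ g : Poly j
    c₀ = eval (constPart P) σ
    r₀ = eval (coefficients P) σ
    g  = eval (greatest P) σ

  -- A positive power of `x` lies below `x`, so the equation is bounded by an affine one, to which
  -- `^∞-induction` applies.
  eval-≲-affine : ∀ x → eval P (x ∷ˢ σ) ≲ c₀ ⊕ r₀ ⊗ x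
  eval-≲-affine x = eval-least P (x ∷ˢ σ) bound
    where
    open ≲-Reasoning
    occurs : ∀ {e p} → fin 1 ≤∞ e → (e ∷ p) ∈ P → pow x e ⊗ evalMon p σ ≲ c₀ ⊕ r₀ ⊗ x
    occurs {e} {p} r i = begin
      pow x e ⊗ evalMon p σ       ≤⟨ ⊗-monoˡ (evalMon p σ) (pow-antitone x r) ⟩
      -- `x ⊗ 𝟙` is the unfolded first power of `x`.
      (x ⊗ 𝟙) ⊗ evalMon p σ       ≤⟨ ⊗-mono (⊗-≲ˡ x 𝟙) (evalMon-≲-eval σ (∈-coefficients r i)) ⟩
      x ⊗ r₀                      ≤⟨ ⊗-comm-≲ x r₀ ⟩
      r₀ ⊗ x                      ≤⟨ b≲a⊕b c₀ (r₀ ⊗ x) ⟩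
      c₀ ⊕ r₀ ⊗ x                 ∎
    bound : ∀ {p} → p ∈ P → evalMon p (x ∷ˢ σ) ≲ c₀ ⊕ r₀ ⊗ x
    bound {fin zero ∷ p} i = begin
      𝟙 ⊗ evalMon p σ             ≤⟨ ⊗-≲ʳ 𝟙 (evalMon p σ) ⟩
      evalMon p σ                 ≤⟨ evalMon-≲-eval σ (∈-constPart i) ⟩
      c₀                          ≤⟨ a≲a⊕b c₀ (r₀ ⊗ x) ⟩
      c₀ ⊕ r₀ ⊗ x                 ∎
    bound {fin (suc _) ∷ p} i = occurs (fin≤fin (s≤s z≤n)) i
    bound {∞ ∷ p}           i = occurs (_ ≤∞∞) i

  -- A converse to the affine bound. Since `coefficients` has lost the exponents, the factor `z`
  -- must lie below every power of `x`.
  affine-≲-eval : ∀ x z → (∀ e → z ≲ pow x e) → c₀ ⊕ r₀ ⊗ z ≲ eval P (x ∷ˢ σ)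
  affine-≲-eval x z z≲ = ⊕-least (eval-least (constPart P) σ const) (≲-intro linear)
    where
    const : ∀ {p} → p ∈ constPart P → evalMon p σ ≲ eval P (x ∷ˢ σ)
    const {p} i = ≲-trans (proj₂ (⊗-identityˡ (evalMon p σ)))
      (evalMon-≲-eval (x ∷ˢ σ) (constPart-∈ P i))
    linear : ∀ {m} → m ∈↓ r₀ ⊗ z → m ∈↓ eval P (x ∷ˢ σ)
    linear i with u , v , u∈ , v∈ , r ← ∈↓-⊗⁻ r₀ z i
      with p , p∈ , s ← ∈↓-eval⁻ (coefficients P) σ (∈⇒∈↓ u∈)
      with e , i ← coefficients-∈ P p∈ = evalMon-≲-eval (x ∷ˢ σ) i .at
        (∈↓-⊗⁺ (z≲ e .at (∈⇒∈↓ v∈)) s (⪰-trans (⪰-reflexive (*ₘ-comm v u)) r))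

  eval-greatest : g ≃ c₀ ⊕ r₀ ^∞
  eval-greatest = ≃-trans (eval-⊕ (constPart P) (coefficients P ^∞) σ)
    (⊕-cong (≃-refl {a = c₀}) (eval-^∞ (coefficients P) σ))

  -- Stated for an inequality rather than a solution, because substituting `H(y)` for `x` in the
  -- second equation leaves only an inequality for `y`.
  greatest-postfixed : ∀ x → x ≲ eval P (x ∷ˢ σ) → x ≲ g
  greatest-postfixed x r =
    ≲-trans (^∞-induction x c₀ r₀ (≲-trans r (eval-≲-affine x))) (proj₂ eval-greatest)

  greatest-fixed : g ≃ eval P (g ∷ˢ σ)
  greatest-fixed = below , above
    where
    open ≲-Reasoning
    r₀^∞≲g : r₀ ^∞ ≲ g
    r₀^∞≲g = ≲-trans (b≲a⊕b c₀ (r₀ ^∞)) (proj₂ eval-greatest)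
    below : g ≲ eval P (g ∷ˢ σ)
    below = begin
      g                       ≈⟨ eval-greatest ⟩
      c₀ ⊕ r₀ ^∞              ≤⟨ ⊕-monoʳ c₀ (^∞-double r₀) ⟩
      c₀ ⊕ r₀ ^∞ ⊗ r₀ ^∞      ≤⟨ ⊕-monoʳ c₀ (⊗-monoˡ (r₀ ^∞) (^∞-≲ r₀)) ⟩
      -- The choice `r₀ ^∞` for `z` works because it lies below all its own powers, and these lie
      -- below the powers of `g`.
      c₀ ⊕ r₀ ⊗ r₀ ^∞         ≤⟨ affine-≲-eval g (r₀ ^∞) (λ e →
                                   ≲-trans (^∞-≲-pow-^∞ r₀ e) (pow-mono e r₀^∞≲g)) ⟩
      eval P (g ∷ˢ σ)         ∎
    above : eval P (g ∷ˢ σ) ≲ g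
    above = begin
      eval P (g ∷ˢ σ)                  ≤⟨ eval-≲-affine g ⟩
      c₀ ⊕ r₀ ⊗ g                      ≤⟨ ⊕-monoʳ c₀ (⊗-monoʳ r₀ (proj₁ eval-greatest)) ⟩
      c₀ ⊕ r₀ ⊗ (c₀ ⊕ r₀ ^∞)           ≤⟨ ⊕-monoʳ c₀ (⊗-distribˡ-⊕-≲ r₀ c₀ (r₀ ^∞)) ⟩
      -- Absorption removes the factor `r₀` from both products.
      c₀ ⊕ (r₀ ⊗ c₀ ⊕ r₀ ⊗ r₀ ^∞)      ≤⟨ ⊕-least (a≲a⊕b c₀ (r₀ ^∞))
                                            (⊕-mono (⊗-≲ʳ r₀ c₀) (⊗-≲ʳ r₀ (r₀ ^∞))) ⟩
      c₀ ⊕ r₀ ^∞                       ≈⟨ eval-greatest ⟨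
      g                                ∎

  -- The map `f` need only agree with evaluation of `P` up to `_≃_`, so that `Q(H(Y),Y)`, a nested
  -- evaluation, is covered as well. The antichain hypothesis converts `_≃_` back to `_≈_`.
  greatestSolution-≃ : {f : Poly j → Poly j} → (∀ x → Antichain (f x)) →
    (∀ x → f x ≃ eval P (x ∷ˢ σ)) → IsGreatestSolution f a → a ≃ g
  greatestSolution-≃ {a = a} f-antichain f≃ (_ , a≈fa , a-greatest) =
    greatest-postfixed a (proj₁ (≃-trans (≈⇒≃ a≈fa) (f≃ a))) ,
    ≤⇒≲ (a-greatest g g-antichain
      (≃⇒≈ g-antichain (f-antichain g) (≃-trans greatest-fixed (≃-sym (f≃ g)))))
    where
    g-antichain = eval-antichain (greatest P) σ

-- The system of two equations

theorem35 : (n : ℕ) (P Q : Poly (suc (suc n))) → Antichain P → Antichain Q →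
    (H : Poly (suc n)) →
    IsGreatestSolution (λ x → eval P (x ∷ˢ var zero ∷ˢ (λ i → var (suc i)))) H →
    (b : Poly n) →
    IsGreatestSolution (λ y → eval Q (eval H (y ∷ˢ var) ∷ˢ y ∷ˢ var)) b →
    IsGreatestSolution₂ (λ x y → eval P (x ∷ˢ y ∷ˢ var)) (λ x y → eval Q (x ∷ˢ y ∷ˢ var))
    (eval H (b ∷ˢ var)) b
theorem35 n P Q _ _ H H-greatest b b-greatest@(b-antichain , b≈ , _) =
  H[b]-antichain , b-antichain ,
  -- The second equation of the system at this pair is literally the fixed-point equation of `b`.
  ≃⇒≈ H[b]-antichain (eval-antichain P (H[ b ] ∷ˢ b ∷ˢ var)) H[b]-fixed , b≈ , dominates
  where
  open ≲-Reasoning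

  -- Written as in the hypothesis on `H`; it agrees with `var` pointwise but not definitionally.
  vars : Fin (suc n) → Poly (suc n)
  vars = var zero ∷ˢ (λ i → var (suc i))

  H[_] : Poly n → Poly n
  H[ y ] = eval H (y ∷ˢ var)

  H[b]-antichain : Antichain H[ b ]
  H[b]-antichain = eval-antichain H (b ∷ˢ var)

  eval-vars : ∀ y i → eval (vars i) (y ∷ˢ var) ≃ (y ∷ˢ var) i
  eval-vars y zero    = eval-var zero (y ∷ˢ var)
  eval-vars y (suc i) = eval-var (suc i) (y ∷ˢ var)

  H-closed : H ≃ eval (greatest P) vars
  H-closed = greatestSolution-≃ P vars (λ x → eval-antichain P (x ∷ˢ vars))
    (λ x → ≃-refl {a = eval P (x ∷ˢ vars)}) H-greatest

  -- With this, the results on one equation apply to `X = P(X,y)` for each `y`, not only for the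
  -- indeterminate `Y`.
  H[]-closed : ∀ y → H[ y ] ≃ eval (greatest P) (y ∷ˢ var)
  H[]-closed y = begin-equality
    eval H (y ∷ˢ var)                                   ≈⟨ eval-congˡ (y ∷ˢ var) H-closed ⟩
    eval (eval (greatest P) vars) (y ∷ˢ var)            ≈⟨ eval-eval (greatest P) vars (y ∷ˢ var) ⟩
    eval (greatest P) (λ i → eval (vars i) (y ∷ˢ var))  ≈⟨ eval-congʳ (greatest P) (eval-vars y) ⟩
    eval (greatest P) (y ∷ˢ var)                        ∎

  H[b]-fixed : H[ b ] ≃ eval P (H[ b ] ∷ˢ b ∷ˢ var)
  H[b]-fixed = begin-equality
    H[ b ]                                             ≈⟨ H[]-closed b ⟩
    eval (greatest P) (b ∷ˢ var)                       ≈⟨ greatest-fixed P (b ∷ˢ var) ⟩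
    eval P (eval (greatest P) (b ∷ˢ var) ∷ˢ b ∷ˢ var)  ≈⟨ eval-congʳ P (∷ˢ-cong (H[]-closed b) (b ∷ˢ var)) ⟨
    eval P (H[ b ] ∷ˢ b ∷ˢ var)                        ∎

  -- Performing the substitution `Q(H(Y),Y)` formally turns the second equation into a polynomial
  -- equation in `Y` alone.
  QH : Poly (suc n)
  QH = eval Q (H ∷ˢ vars)

  eval-H∷vars : ∀ y i → eval ((H ∷ˢ vars) i) (y ∷ˢ var) ≃ (H[ y ] ∷ˢ y ∷ˢ var) i
  eval-H∷vars y zero    = ≃-refl {a = H[ y ]}
  eval-H∷vars y (suc i) = eval-vars y i

  eval-QH : ∀ y → eval Q (H[ y ] ∷ˢ y ∷ˢ var) ≃ eval QH (y ∷ˢ var)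
  eval-QH y = ≃-sym (≃-trans (eval-eval Q (H ∷ˢ vars) (y ∷ˢ var)) (eval-congʳ Q (eval-H∷vars y)))

  b-closed : b ≃ eval (greatest QH) var
  b-closed = greatestSolution-≃ QH var (λ y → eval-antichain Q (H[ y ] ∷ˢ y ∷ˢ var))
    eval-QH b-greatest

  dominates : ∀ x y → Antichain x → Antichain y →
    x ≈ eval P (x ∷ˢ y ∷ˢ var) → y ≈ eval Q (x ∷ˢ y ∷ˢ var) → x ≤ H[ b ] × y ≤ b
  dominates x y _ _ x≈ y≈ = ≲⇒≤ H[b]-antichain x≲H[b] , ≲⇒≤ b-antichain y≲b
    where
    x≲H[y] : x ≲ H[ y ]
    x≲H[y] = begin
      x                             ≤⟨ greatest-postfixed P (y ∷ˢ var) x (proj₁ (≈⇒≃ x≈)) ⟩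
      eval (greatest P) (y ∷ˢ var)  ≈⟨ H[]-closed y ⟨
      H[ y ]                        ∎
    -- Equality is lost here: `x` is a solution of the first equation at `y`, but possibly below the
    -- greatest one.
    y≲QH : y ≲ eval QH (y ∷ˢ var)
    y≲QH = begin
      y                            ≈⟨ ≈⇒≃ y≈ ⟩
      eval Q (x ∷ˢ y ∷ˢ var)       ≤⟨ eval-monoʳ Q (∷ˢ-mono x≲H[y] (y ∷ˢ var)) ⟩
      eval Q (H[ y ] ∷ˢ y ∷ˢ var)  ≈⟨ eval-QH y ⟩
      eval QH (y ∷ˢ var)           ∎
    y≲b : y ≲ b
    y≲b = ≲-trans (greatest-postfixed QH var y y≲QH) (proj₂ b-closed)
    x≲H[b] : x ≲ H[ b ]
    x≲H[b] = ≲-trans x≲H[y] (eval-monoʳ H (∷ˢ-mono y≲b var))
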